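{- Let $n\ge 3$ and $k\ge 1$, and let $H\in\mathcal{H}_k$. Then \[ \Gamma_{\rm S}(C_n,H)=kn+\left\lceil \frac{n}{3}\right\rceil . \]
   Context: $C_n$ is the cycle on $n$ vertices; $\gamma$ is the domination number. For $k\ge 1$, $\mathcal{H}_k$ is the class of all finite graphs $H$ with the following two properties: (a) $\gamma(H)=k+1$ and $\gamma(H-v)=k$ for every vertex $v\in V(H)$; (b) for all $x,y\in V(H)$ (where $x=y$ is allowed) there exists a minimum dominating set of $H$ containing both $x$ and $y$. For graphs $G,H$ and a function $f\colon V(G)\to V(H)$, the Sierpiński product $G\otimes_f H$ is the graph with vertex set $V(G)\times V(H)$ and edges of two types: (type 1) $(g,h)(g,h')$ for every $g\in V(G)$ and every edge $hh'\in E(H)$; (type 2) $(g,f(g'))(g',f(g))$ for every edge $gg'\in E(G)$. $\Gamma_{\rm S}(G,H)=\max_{f}\gamma(G\otimes_f H)$ over all functions $f\colon V(G)\to V(H)$. -}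

module Defs where

open import Data.Empty using (⊥-elim)
open import Data.Fin.Base using (Fin; toℕ; punchIn; remQuot)
open import Data.Fin.Properties using (_≟_; all?; any?)
open import Data.Fin.Subset using (Subset; Side; inside; outside; _∈_; ∣_∣)
open import Data.Fin.Subset.Properties using (_∈?_)
open import Data.List.Base using (List; []; _∷_; [_]; map; filter; allFin; cartesianProductWith)
open import Data.List.Extrema.Nat using (min; max)
open import Data.Nat.Base using (ℕ; zero; suc; pred; _+_; _*_; _≤_; z≤n; s≤s)
open import Data.Nat.DivMod using (_/_)
open import Data.Nat.Properties using (1+n≢n) renaming (_≟_ to _≟ℕ_)
open import Data.Product.Base using (_×_; _,_; ∃-syntax)
open import Data.Sum.Base using (_⊎_; inj₁; inj₂; swap)
open import Data.Vec.Base as Vec using (Vec; lookup)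
open import Level using (0ℓ)
open import Relation.Binary.Core using (Rel)
open import Relation.Binary.Definitions using (Symmetric; Decidable)
open import Relation.Binary.PropositionalEquality using (_≡_; refl; sym; trans; cong)
open import Relation.Nullary.Decidable using (Dec; _×-dec_; _⊎-dec_)
open import Relation.Nullary.Negation using (¬_)

-- Finite simple graphs on the vertex set Fin n.
record Graph (n : ℕ) : Set₁ where
  field
    Adj    : Rel (Fin n) 0ℓ
    symm   : Symmetric Adj
    irrefl : ∀ v → ¬ Adj v v
    adj?   : Decidable Adj

open Graph public

-- The vertices other than v are relabelled by punchIn v, the
-- order-preserving bijection from Fin (pred n) onto Fin n ∖ {v}.
delete : ∀ {n} → Graph n → Fin n → Graph (pred n)
delete {zero}  G ()
delete {suc n} G v = record
  { Adj    = λ x y → Adj G (punchIn v x) (punchIn v y)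
  ; symm   = symm G
  ; irrefl = λ x → irrefl G (punchIn v x)
  ; adj?   = λ x y → adj? G (punchIn v x) (punchIn v y)
  }

-- j follows i in the cyclic order 0, 1, …, n - 1, 0.
Next : ∀ {n} → Rel (Fin n) 0ℓ
Next {n} i j = (suc (toℕ i) ≡ toℕ j) ⊎ ((suc (toℕ i) ≡ n) × (toℕ j ≡ 0))

next? : ∀ {n} → Decidable (Next {n})
next? {n} i j = (suc (toℕ i) ≟ℕ toℕ j) ⊎-dec ((suc (toℕ i) ≟ℕ n) ×-dec (toℕ j ≟ℕ 0))

next-irrefl : ∀ {n} → 3 ≤ n → (i : Fin n) → ¬ Next i i
next-irrefl _ i (inj₁ eq) = 1+n≢n eq
next-irrefl {n} 3≤n i (inj₂ (p , q)) = absurd 3≤n (trans (sym p) (cong suc q))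
  where
  absurd : ∀ {l} → 3 ≤ l → ¬ (l ≡ 1)
  absurd (s≤s ()) refl

C : ∀ n → 3 ≤ n → Graph n
C n 3≤n = record
  { Adj    = λ i j → Next i j ⊎ Next j i
  ; symm   = swap
  ; irrefl = λ { i (inj₁ p) → next-irrefl 3≤n i p
               ; i (inj₂ p) → next-irrefl 3≤n i p }
  ; adj?   = λ i j → next? i j ⊎-dec next? j i
  }

Dominating : ∀ {n} → Graph n → Subset n → Set
Dominating G S = ∀ v → v ∈ S ⊎ (∃[ u ] u ∈ S × Adj G u v)

dominating? : ∀ {n} (G : Graph n) (S : Subset n) → Dec (Dominating G S)
dominating? G S = all? λ v → (v ∈? S) ⊎-dec any? λ u → (u ∈? S) ×-dec adj? G u v

-- All vectors of length n with entries in the list xs.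
vectors : ∀ {A : Set} → List A → ∀ n → List (Vec A n)
vectors xs zero    = [ Vec.[] ]
vectors xs (suc n) = cartesianProductWith Vec._∷_ xs (vectors xs n)

subsets : ∀ n → List (Subset n)
subsets = vectors (inside ∷ outside ∷ [])

functions : ∀ m n → List (Fin m → Fin n)
functions m n = map lookup (vectors (allFin n) m)

-- The first argument of min is only a default, and does not affect the
-- value: the whole vertex set is dominating and has size n.
γ : ∀ {n} → Graph n → ℕ
γ {n} G = min n (map ∣_∣ (filter (dominating? G) (subsets n)))

MinimumDominating : ∀ {n} → Graph n → Subset n → Set
MinimumDominating G S = Dominating G S × (∣ S ∣ ≡ γ G)

record 𝓗 (k : ℕ) {n : ℕ} (H : Graph n) : Set where
  field
    γ-graph  : γ H ≡ k + 1
    γ-delete : ∀ v → γ (delete H v) ≡ k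
    pairs    : ∀ x y → ∃[ S ] MinimumDominating H S × x ∈ S × y ∈ S

module _ {m n : ℕ} (G : Graph m) (f : Fin m → Fin n) (H : Graph n) where

  -- An edge (g , f g′)(g′ , f g) is recovered from its end (g , h) and
  -- (g′ , h′) by h ≡ f g′ and h′ ≡ f g.
  SierpińskiAdj : Rel (Fin m × Fin n) 0ℓ
  SierpińskiAdj (g , h) (g′ , h′) =
    (g ≡ g′ × Adj H h h′) ⊎ (Adj G g g′ × h ≡ f g′ × h′ ≡ f g)

  sierpiński-symm : Symmetric SierpińskiAdj
  sierpiński-symm (inj₁ (p , e))     = inj₁ (sym p , symm H e)
  sierpiński-symm (inj₂ (e , p , q)) = inj₂ (symm G e , q , p)

  sierpiński-irrefl : ∀ v → ¬ SierpińskiAdj v v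
  sierpiński-irrefl (g , h) (inj₁ (_ , e)) = irrefl H h e
  sierpiński-irrefl (g , h) (inj₂ (e , _)) = irrefl G g e

  sierpiński-adj? : Decidable SierpińskiAdj
  sierpiński-adj? (g , h) (g′ , h′) =
    ((g ≟ g′) ×-dec adj? H h h′) ⊎-dec
    (adj? G g g′ ×-dec ((h ≟ f g′) ×-dec (h′ ≟ f g)))

  -- The vertex set Fin m × Fin n is represented by Fin (m * n) through
  -- the bijection remQuot, whose inverse is combine.
  sierpińskiProduct : Graph (m * n)
  sierpińskiProduct = record
    { Adj    = λ u v → SierpińskiAdj (remQuot n u) (remQuot n v)
    ; symm   = sierpiński-symm
    ; irrefl = λ v → sierpiński-irrefl (remQuot n v)
    ; adj?   = λ u v → sierpiński-adj? (remQuot n u) (remQuot n v)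
    }

-- The default 0 matters only when there is no function Fin m → Fin n.
ΓS : ∀ {m n} → Graph m → Graph n → ℕ
ΓS {m} {n} G H = max 0 (map (λ f → γ (sierpińskiProduct G f H)) (functions m n))

-- ⌈ n / 3 ⌉, with _/_ rounding down.
⌈_/3⌉ : ℕ → ℕ
⌈ n /3⌉ = (n + 2) / 3

{-# OPTIONS --safe #-}
-- Lower bound: take f constant, equal to v, and let S be dominating. The trace
-- of S on a copy of H dominates that copy except possibly at v, so it has at
-- least k elements, and at least k + 1 if it is dominating. A trace that misses
-- v relies on a neighbouring trace containing v, which is then dominating. Hence
-- the copies with at least k + 1 elements dominate the cycle: three consecutive
-- traces have at least 3k + 1 elements together, and one sums around the cycle.
--
-- Upper bound: for any f, the positions divisible by 3 dominate the cycle. On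
-- the copies there take a minimum dominating set of H containing both
-- attachment vertices; every other copy then has a vertex dominated from such a
-- copy, and k elements suffice for the rest of it.
module Submission where

open import Defs
open import Data.Bool.Base using (Bool; true; false; if_then_else_)
open import Data.Fin.Base
  using (Fin; zero; suc; toℕ; fromℕ; fromℕ<; inject₁; punchIn; punchOut; combine)
open import Data.Fin.Properties
  using (_≟_; toℕ-injective; toℕ-fromℕ; toℕ-fromℕ<; toℕ-inject₁; toℕ<n;
         remQuot-combine; combine-surjective; punchIn-punchOut)
open import Data.Fin.Subset using (Subset; outside; _∈_; ∣_∣; _∪_; ⁅_⁆; ⊤)
open import Data.Fin.Subset.Properties
  using (x∈p∪q⁺; x∈⁅x⁆; ∪-identityʳ; ∈⊤; ∣⊤∣≡n)
open import Data.List.Base using (List; map; filter)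
open import Data.List.Extrema.Nat using (min≤v⁺; argmin-sel; max≤v⁺; v≤max⁺)
open import Data.List.Membership.Propositional using () renaming (_∈_ to _∈ᴸ_)
open import Data.List.Membership.Propositional.Properties
  using (∈-map⁺; ∈-map⁻; ∈-filter⁺; ∈-filter⁻; ∈-allFin; ∈-cartesianProductWith⁺)
open import Data.List.Relation.Unary.Any as Any using (here; there)
import Data.List.Relation.Unary.All as All
open import Data.Nat.Base using (ℕ; zero; suc; _+_; _*_; _≤_; _<_; z≤n; s≤s)
open import Data.Nat.Divisibility using (∣-refl; n∣m*n)
open import Data.Nat.DivMod using (_/_; m*n/n≡m; /-monoˡ-≤; +-distrib-/-∣ˡ)
open import Data.Nat.Properties
  using (≤-reflexive; ≤-trans; ≤-antisym; m≤n⇒m≤1+n; +-comm; *-comm;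
         +-monoˡ-≤; +-mono-≤; suc-injective; <⇒≢; _<?_; ≮⇒≥;
         +-0-commutativeMonoid; module ≤-Reasoning)
open import Data.Nat.Solver using (module +-*-Solver)
open import Data.Product.Base using (_×_; _,_; ∃-syntax; proj₁; proj₂)
open import Data.Sum.Base using (_⊎_; inj₁; inj₂)
open import Data.Vec.Base as Vec 
  using (Vec; []; _∷_; lookup; tabulate; replicate; concat; group; insertAt)
open import Data.Vec.Properties
  using (lookup-concat; lookup-replicate; lookup∘tabulate; []=⇒lookup; lookup⇒[]=; insertAt-punchIn)
open import Algebra.Properties.CommutativeMonoid.Sum +-0-commutativeMonoid
  using (sum; sum-cong-≗; ∑-distrib-+; sum-init-last)
open import Function.Base using (_∘_)
open import Relation.Binary.PropositionalEquality
open import Relation.Nullary.Decidable using (yes; no)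
open import Relation.Nullary.Negation using (contradiction)

-- Minimum dominating sets, and the extremal values `γ` and `ΓS`.

∈-vectors : ∀ {A : Set} {xs : List A} → (∀ x → x ∈ᴸ xs) → ∀ {n} (v : Vec A n) → v ∈ᴸ vectors xs n
∈-vectors all []      = here refl
∈-vectors all (x ∷ v) = ∈-cartesianProductWith⁺ _∷_ (all x) (∈-vectors all v)

∈-subsets : ∀ {n} (S : Subset n) → S ∈ᴸ subsets n
∈-subsets = ∈-vectors λ where
  true  → here refl
  false → there (here refl)

γ-minimal : ∀ {n} (G : Graph n) (S : Subset n) → Dominating G S → γ G ≤ ∣ S ∣
γ-minimal {n} G S dom = min≤v⁺ n _ (inj₂ (Any.map (≤-reflexive ∘ sym)
  (∈-map⁺ ∣_∣ (∈-filter⁺ (dominating? G) (∈-subsets S) dom))))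

minimumDominating : ∀ {n} (G : Graph n) → ∃[ S ] MinimumDominating G S
minimumDominating {n} G
  with argmin-sel (λ x → x) n (map ∣_∣ (filter (dominating? G) (subsets n)))
-- Here `min` returns its default `n`, which the whole vertex set attains.
... | inj₁ γ≡n = ⊤ , (λ _ → inj₁ ∈⊤) , trans (∣⊤∣≡n n) (sym γ≡n)
... | inj₂ γ∈ with S , S∈ , γ≡ ← ∈-map⁻ ∣_∣ γ∈ =
  S , proj₂ (∈-filter⁻ (dominating? G) {xs = subsets n} S∈) , sym γ≡

ΓS-upper : ∀ {m n b} (G : Graph m) (H : Graph n) →
  (∀ f → γ (sierpińskiProduct G f H) ≤ b) → ΓS G H ≤ b
ΓS-upper {m} {n} {b} G H bound = max≤v⁺ z≤n (All.tabulate below)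
  where
  below : ∀ {x} → x ∈ᴸ map (λ f → γ (sierpińskiProduct G f H)) (functions m n) → x ≤ b
  below x∈ with f , _ , refl ← ∈-map⁻ _ x∈ = bound f

-- `functions` lists only maps of the form `lookup xs`, so constancy is asked for pointwise:
-- `lookup (replicate m v)` is not definitionally a constant map.
ΓS-lower : ∀ {m n b} (G : Graph m) (H : Graph n) (v : Fin n) →
  (∀ f → (∀ g → f g ≡ v) → b ≤ γ (sierpińskiProduct G f H)) → b ≤ ΓS G H
ΓS-lower {m} {n} G H v bound = v≤max⁺ 0 _ (inj₂ (Any.map (λ { refl → bound _ const-v })
  (∈-map⁺ (λ f → γ (sierpińskiProduct G f H))
    (∈-map⁺ lookup (∈-vectors ∈-allFin (replicate m v))))))
  where
  const-v : ∀ g → lookup (replicate m v) g ≡ v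
  const-v g = lookup-replicate g v

-- Sets dominating all vertices but one.

DominatesAt : ∀ {n} → Graph n → Subset n → Fin n → Set
DominatesAt G S v = v ∈ S ⊎ (∃[ u ] u ∈ S × Adj G u v)

∣p∪⁅x⁆∣≤1+∣p∣ : ∀ {n} (p : Subset n) x → ∣ p ∪ ⁅ x ⁆ ∣ ≤ suc ∣ p ∣
∣p∪⁅x⁆∣≤1+∣p∣ (true  ∷ p) zero    = s≤s (m≤n⇒m≤1+n (≤-reflexive (cong ∣_∣ (∪-identityʳ p))))
∣p∪⁅x⁆∣≤1+∣p∣ (false ∷ p) zero    = s≤s (≤-reflexive (cong ∣_∣ (∪-identityʳ p)))
∣p∪⁅x⁆∣≤1+∣p∣ (true  ∷ p) (suc x) = s≤s (∣p∪⁅x⁆∣≤1+∣p∣ p x)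
∣p∪⁅x⁆∣≤1+∣p∣ (false ∷ p) (suc x) = ∣p∪⁅x⁆∣≤1+∣p∣ p x

-- Adding `v` to `S` completes it to a dominating set.
γ≤1+∣S∣ : ∀ {n} (G : Graph n) (S : Subset n) v →
  (∀ u → u ≢ v → DominatesAt G S u) → γ G ≤ suc ∣ S ∣
γ≤1+∣S∣ G S v dom = ≤-trans (γ-minimal G (S ∪ ⁅ v ⁆) dom∪) (∣p∪⁅x⁆∣≤1+∣p∣ S v)
  where
  dom∪ : Dominating G (S ∪ ⁅ v ⁆)
  dom∪ u with u ≟ v
  ... | yes refl = inj₁ (x∈p∪q⁺ (inj₂ (x∈⁅x⁆ v)))
  ... | no u≢v with dom u u≢v
  ...   | inj₁ u∈S            = inj₁ (x∈p∪q⁺ (inj₁ u∈S))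
  ...   | inj₂ (w , w∈S , wu) = inj₂ (w , x∈p∪q⁺ (inj₁ w∈S) , wu)

∣insertAt-outside∣ : ∀ {n} (S : Subset n) v → ∣ insertAt S v outside ∣ ≡ ∣ S ∣
∣insertAt-outside∣ S           zero    = refl
∣insertAt-outside∣ (true  ∷ S) (suc v) = cong suc (∣insertAt-outside∣ S v)
∣insertAt-outside∣ (false ∷ S) (suc v) = ∣insertAt-outside∣ S v

-- A minimum dominating set of `delete G v` is carried along `punchIn v`. It supplies the traces of
-- size `k` in the upper bound.
γ-delete-witness : ∀ {n} (G : Graph n) v →
  ∃[ S ] ∣ S ∣ ≡ γ (delete G v) × (∀ u → u ≢ v → DominatesAt G S u)
γ-delete-witness {suc n} G v with T , domT , ∣T∣≡γ ← minimumDominating (delete G v) =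
  S , trans (∣insertAt-outside∣ T v) ∣T∣≡γ , dom
  where
  S = insertAt T v outside
  lift : ∀ {u} → u ∈ T → punchIn v u ∈ S
  lift {u} u∈T = lookup⇒[]= _ S (trans (insertAt-punchIn T v outside u) ([]=⇒lookup u∈T))
  domAt : ∀ u → DominatesAt G S (punchIn v u)
  domAt u with domT u
  ... | inj₁ u∈T            = inj₁ (lift u∈T)
  ... | inj₂ (w , w∈T , wu) = inj₂ (punchIn v w , lift w∈T , wu)
  dom : ∀ u → u ≢ v → DominatesAt G S u
  dom u u≢v = subst (DominatesAt G S) (punchIn-punchOut (u≢v ∘ sym)) (domAt (punchOut (u≢v ∘ sym)))

-- Subsets of the product as families of traces.

∣++∣ : ∀ {m n} (p : Subset m) (q : Subset n) → ∣ p Vec.++ q ∣ ≡ ∣ p ∣ + ∣ q ∣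
∣++∣ []          q = refl
∣++∣ (true  ∷ p) q = cong suc (∣++∣ p q)
∣++∣ (false ∷ p) q = ∣++∣ p q

∣concat∣ : ∀ {m n} (Ss : Vec (Subset n) m) → ∣ concat Ss ∣ ≡ sum (λ g → ∣ lookup Ss g ∣)
∣concat∣ []       = refl
∣concat∣ (S ∷ Ss) = trans (∣++∣ S (concat Ss)) (cong (∣ S ∣ +_) (∣concat∣ Ss))

module _ {m n : ℕ} (G : Graph m) (f : Fin m → Fin n) (H : Graph n) (Ss : Vec (Subset n) m) where

  -- The last alternative is domination through the type 2 edge (g′ , f g)(g , f g′).
  ProductDominating : Set
  ProductDominating = ∀ g h → DominatesAt H (lookup Ss g) h
    ⊎ (∃[ g′ ] Adj G g′ g × f g ∈ lookup Ss g′ × h ≡ f g′)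

  -- `concat` stores entry `h` of block `g` at `combine g h`, which is how the product encodes
  -- `(g , h)`.
  ∈-concat⁺ : ∀ {g h} → h ∈ lookup Ss g → combine g h ∈ concat Ss
  ∈-concat⁺ {g} {h} h∈ = lookup⇒[]= _ (concat Ss) (trans (lookup-concat Ss g h) ([]=⇒lookup h∈))

  ∈-concat⁻ : ∀ {g h} → combine g h ∈ concat Ss → h ∈ lookup Ss g
  ∈-concat⁻ {g} {h} gh∈ = lookup⇒[]= _ (lookup Ss g) (trans (sym (lookup-concat Ss g h)) ([]=⇒lookup gh∈))

  combine-adj⁺ : ∀ {g h g′ h′} → SierpińskiAdj G f H (g , h) (g′ , h′) →
    Adj (sierpińskiProduct G f H) (combine g h) (combine g′ h′)
  combine-adj⁺ {g} {h} {g′} {h′} =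
    subst₂ (SierpińskiAdj G f H) (sym (remQuot-combine g h)) (sym (remQuot-combine g′ h′))

  combine-adj⁻ : ∀ {g h g′ h′} → Adj (sierpińskiProduct G f H) (combine g h) (combine g′ h′) →
    SierpińskiAdj G f H (g , h) (g′ , h′)
  combine-adj⁻ {g} {h} {g′} {h′} =
    subst₂ (SierpińskiAdj G f H) (remQuot-combine g h) (remQuot-combine g′ h′)

  productDominating⁺ : ProductDominating → Dominating (sierpińskiProduct G f H) (concat Ss)
  productDominating⁺ dom x with g , h , refl ← combine-surjective {m} {n} x with dom g h
  ... | inj₁ (inj₁ h∈)            = inj₁ (∈-concat⁺ h∈)
  ... | inj₁ (inj₂ (u , u∈ , uh)) = inj₂ (_ , ∈-concat⁺ u∈ , combine-adj⁺ (inj₁ (refl , uh)))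
  ... | inj₂ (g′ , g′g , f∈ , h≡) = inj₂ (_ , ∈-concat⁺ f∈ , combine-adj⁺ (inj₂ (g′g , refl , h≡)))

  productDominating⁻ : Dominating (sierpińskiProduct G f H) (concat Ss) → ProductDominating
  productDominating⁻ dom g h with dom (combine g h)
  ... | inj₁ gh∈ = inj₁ (inj₁ (∈-concat⁻ gh∈))
  ... | inj₂ (x , x∈ , adj) with g′ , u , refl ← combine-surjective {m} {n} x
        with combine-adj⁻ adj
  ...   | inj₁ (refl , uh)         = inj₁ (inj₂ (u , ∈-concat⁻ x∈ , uh))
  ...   | inj₂ (g′g , refl , h≡) = inj₂ (g′ , g′g , ∈-concat⁻ x∈ , h≡)

-- The cycle and sums around it.

next-injectiveˡ : ∀ {n} {i j k : Fin n} → Next i k → Next j k → i ≡ j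
next-injectiveˡ (inj₁ p)       (inj₁ q)       = toℕ-injective (suc-injective (trans p (sym q)))
next-injectiveˡ (inj₁ p)       (inj₂ (_ , q)) = contradiction (trans p q) λ ()
next-injectiveˡ (inj₂ (_ , p)) (inj₁ q)       = contradiction (trans q p) λ ()
next-injectiveˡ (inj₂ (p , _)) (inj₂ (q , _)) = toℕ-injective (suc-injective (trans p (sym q)))

next-injectiveʳ : ∀ {n} {i j k : Fin n} → Next i j → Next i k → j ≡ k
next-injectiveʳ (inj₁ p)       (inj₁ q)       = toℕ-injective (trans (sym p) q)
next-injectiveʳ {j = j} (inj₁ p) (inj₂ (q , _)) = contradiction (trans (sym p) q) (<⇒≢ (toℕ<n j))
next-injectiveʳ {k = k} (inj₂ (p , _)) (inj₁ q) = contradiction (trans (sym q) p) (<⇒≢ (toℕ<n k))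
next-injectiveʳ (inj₂ (_ , p)) (inj₂ (_ , q)) = toℕ-injective (trans p (sym q))

prev : ∀ {n} → Fin (suc n) → Fin (suc n)
prev {n} zero = fromℕ n
prev (suc i)  = inject₁ i

prev-next : ∀ {n} (i : Fin (suc n)) → Next (prev i) i
prev-next {n} zero = inj₂ (cong suc (toℕ-fromℕ n) , refl)
prev-next (suc i)  = inj₁ (cong suc (toℕ-inject₁ i))

successor : ∀ {n} (i : Fin (suc n)) → ∃[ j ] Next i j
successor {n} i with suc (toℕ i) <? suc n
... | yes i< = fromℕ< i< , inj₁ (sym (toℕ-fromℕ< i<))
... | no i≮  = zero , inj₂ (≤-antisym (toℕ<n i) (≮⇒≥ i≮) , refl)

-- Since two vertices exhaust the neighbours, `pairs` can put all attachment vertices of a copy into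
-- one minimum dominating set.
cycle-neighbours : ∀ n (3≤n : 3 ≤ n) x →
  ∃[ p ] ∃[ q ] (∀ y → Adj (C n 3≤n) y x → y ≡ p ⊎ y ≡ q)
cycle-neighbours (suc n) 3≤n x = prev x , proj₁ (successor x) , λ where
  y (inj₁ e) → inj₁ (next-injectiveˡ e (prev-next x))
  y (inj₂ e) → inj₂ (next-injectiveʳ e (proj₂ (successor x)))

-- The terms are rotated: the last comes first, the others keep their order.
sum-prev : ∀ {n} (t : Fin (suc n) → ℕ) → sum (t ∘ prev) ≡ sum t
sum-prev {n} t = trans (+-comm (t (fromℕ n)) _) (sym (sum-init-last t))

sum-mono-≤ : ∀ {n} {s t : Fin n → ℕ} → (∀ i → s i ≤ t i) → sum s ≤ sum t
sum-mono-≤ {zero}  s≤t = z≤n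
sum-mono-≤ {suc n} s≤t = +-mono-≤ (s≤t zero) (sum-mono-≤ (s≤t ∘ suc))

sum-const : ∀ n c → sum {n} (λ _ → c) ≡ n * c
sum-const zero    c = refl
sum-const (suc n) c = cong (c +_) (sum-const n c)

-- Each of the three summands is a rotation of `t`, and rotation keeps the sum.
sum-consecutive-triples : ∀ {n} (t : Fin (suc n) → ℕ) →
  sum (λ i → t (prev (prev i)) + t (prev i) + t i) ≡ sum t * 3
sum-consecutive-triples t = begin
  sum (λ i → t (prev (prev i)) + t (prev i) + t i)      ≡⟨ ∑-distrib-+ (λ i → t (prev (prev i)) + t (prev i)) t ⟩
  sum (λ i → t (prev (prev i)) + t (prev i)) + sum t    ≡⟨ cong (_+ sum t) (∑-distrib-+ (t ∘ prev ∘ prev) (t ∘ prev)) ⟩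
  sum (t ∘ prev ∘ prev) + sum (t ∘ prev) + sum t        ≡⟨ cong₂ (λ x y → x + y + sum t) (trans (sum-prev (t ∘ prev)) (sum-prev t)) (sum-prev t) ⟩
  sum t + sum t + sum t                                 ≡⟨ solve 1 (λ x → x :+ x :+ x := x :* con 3) refl (sum t) ⟩
  sum t * 3                                             ∎
  where
  open ≡-Reasoning
  open +-*-Solver

-- Add 2 and divide by 3: on the left this rounds `n / 3` up, on the right the added 2 is lost.
m*3+n≤o*3⇒m+⌈n/3⌉≤o : ∀ m n o → m * 3 + n ≤ o * 3 → m + ⌈ n /3⌉ ≤ o
m*3+n≤o*3⇒m+⌈n/3⌉≤o m n o le = begin
  m + (n + 2) / 3          ≡⟨ cong (_+ (n + 2) / 3) (m*n/n≡m m 3) ⟨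
  m * 3 / 3 + (n + 2) / 3  ≡⟨ +-distrib-/-∣ˡ (n + 2) (n∣m*n m) ⟨
  (m * 3 + (n + 2)) / 3    ≤⟨ /-monoˡ-≤ 3 (≤-trans (≤-reflexive (solve 2 (λ a b → a :+ (b :+ con 2) := a :+ b :+ con 2) refl (m * 3) n)) (+-monoˡ-≤ 2 le)) ⟩
  -- The `0` is the value of `2 / 3`.
  (o * 3 + 2) / 3          ≡⟨ +-distrib-/-∣ˡ 2 (n∣m*n o) ⟩
  o * 3 / 3 + 0            ≡⟨ cong (_+ 0) (m*n/n≡m o 3) ⟩
  o + 0                    ≡⟨ +-comm o 0 ⟩
  o                        ∎
  where
  open ≤-Reasoning
  open +-*-Solver

-- Lower bound: traces for a constant `f`.

module _ {m n k : ℕ} (G : Graph m) (f : Fin m → Fin n) (H : Graph n) (γH : γ H ≡ k + 1)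
         (v : Fin n) (f≡v : ∀ g → f g ≡ v)
         (Ss : Vec (Subset n) m) (dom : ProductDominating G f H Ss) where

  private
    size : Fin m → ℕ
    size g = ∣ lookup Ss g ∣

    γH′ : γ H ≡ suc k
    γH′ = trans γH (+-comm k 1)

  -- Type 2 edges meet every copy only at `v`, so any other vertex is dominated from within its own
  -- copy.
  trace-dominatesAt : ∀ g h → h ≢ v → DominatesAt H (lookup Ss g) h
  trace-dominatesAt g h h≢v with dom g h
  ... | inj₁ d                = d
  ... | inj₂ (g′ , _ , _ , h≡) = contradiction (trans h≡ (f≡v g′)) h≢v

  -- With `v` added, the trace dominates `H`, which takes at least `k + 1` vertices.
  k≤∣trace∣ : ∀ g → k ≤ size g
  k≤∣trace∣ g with s≤s k≤ ← subst (_≤ suc (size g)) γH′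
                 (γ≤1+∣S∣ H (lookup Ss g) v (trace-dominatesAt g)) = k≤

  dominatesAt-v⇒k<∣trace∣ : ∀ g → DominatesAt H (lookup Ss g) v → k < size g
  dominatesAt-v⇒k<∣trace∣ g d = subst (_≤ size g) γH′ (γ-minimal H (lookup Ss g) all)
    where
    all : Dominating H (lookup Ss g)
    all h with h ≟ v
    ... | yes refl = d
    ... | no h≢v   = trace-dominatesAt g h h≢v

  -- If `v` is dominated through a type 2 edge, the other end is `v` in copy `g′`, so the trace
  -- there leaves nothing undominated.
  large-trace-nearby : ∀ g → k < size g ⊎ (∃[ g′ ] Adj G g′ g × k < size g′)
  large-trace-nearby g with dom g v
  ... | inj₁ d = inj₁ (dominatesAt-v⇒k<∣trace∣ g d)
  ... | inj₂ (g′ , g′g , f∈ , _) =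
    inj₂ (g′ , g′g , dominatesAt-v⇒k<∣trace∣ g′ (inj₁ (subst (_∈ lookup Ss g′) (f≡v g) f∈)))

lower-bound : ∀ n k (3≤n : 3 ≤ n) {m} (H : Graph m) → γ H ≡ k + 1 → (v : Fin m) →
  ∀ f → (∀ g → f g ≡ v) → k * n + ⌈ n /3⌉ ≤ γ (sierpińskiProduct (C n 3≤n) f H)
lower-bound n@(suc _) k 3≤n {m} H γH v f f≡v
  with S , domS , ∣S∣≡γ ← minimumDominating (sierpińskiProduct (C n 3≤n) f H)
  with Ss , refl ← group n m S =
  subst (k * n + ⌈ n /3⌉ ≤_) (trans (sym (∣concat∣ Ss)) ∣S∣≡γ)
    (m*3+n≤o*3⇒m+⌈n/3⌉≤o (k * n) n (sum size) bound)
  where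
  size : Fin n → ℕ
  size g = ∣ lookup Ss g ∣

  dom : ProductDominating (C n 3≤n) f H Ss
  dom = productDominating⁻ (C n 3≤n) f H Ss domS

  k≤size : ∀ g → k ≤ size g
  k≤size = k≤∣trace∣ (C n 3≤n) f H γH v f≡v Ss dom

  triple : ∀ i → suc (k + k + k) ≤ size (prev (prev i)) + size (prev i) + size i
  -- The window is centred at `prev i`, whose neighbours are `prev (prev i)` and `i`, so the large
  -- trace falls inside the window.
  triple i with large-trace-nearby (C n 3≤n) f H γH v f≡v Ss dom (prev i)
  ... | inj₁ k< = ≤-trans (≤-reflexive (solve 1 (λ x → con 1 :+ (x :+ x :+ x) := x :+ (con 1 :+ x) :+ x) refl k))
                    (+-mono-≤ (+-mono-≤ (k≤size _) k<) (k≤size i))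
    where open +-*-Solver
  ... | inj₂ (g′ , inj₁ g′→ , k<) with refl ← next-injectiveˡ g′→ (prev-next (prev i)) =
    +-mono-≤ (+-mono-≤ k< (k≤size _)) (k≤size i)
  ... | inj₂ (g′ , inj₂ →g′ , k<) with refl ← next-injectiveʳ →g′ (prev-next i) =
    ≤-trans (≤-reflexive (solve 1 (λ x → con 1 :+ (x :+ x :+ x) := x :+ x :+ (con 1 :+ x)) refl k))
      (+-mono-≤ (+-mono-≤ (k≤size _) (k≤size _)) k<)
    where open +-*-Solver

  bound : k * n * 3 + n ≤ sum size * 3
  bound = begin
    k * n * 3 + n                ≡⟨ solve 2 (λ x y → x :* y :* con 3 :+ y := y :* (con 1 :+ (x :+ x :+ x))) refl k n ⟩
    n * suc (k + k + k)          ≡⟨ sum-const n _ ⟨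
    sum {n} (λ _ → suc (k + k + k))                              ≤⟨ sum-mono-≤ triple ⟩
    sum (λ i → size (prev (prev i)) + size (prev i) + size i)    ≡⟨ sum-consecutive-triples size ⟩
    sum size * 3                 ∎
    where
    open ≤-Reasoning
    open +-*-Solver

-- Upper bound: centres at the multiples of 3.

multipleOf3 : ℕ → Bool
multipleOf3 0                   = true
multipleOf3 1                   = false
multipleOf3 2                   = false
multipleOf3 (suc (suc (suc i))) = multipleOf3 i

⌈3+n/3⌉ : ∀ n → ⌈ 3 + n /3⌉ ≡ suc ⌈ n /3⌉
⌈3+n/3⌉ n = +-distrib-/-∣ˡ {3} (n + 2) {3} ∣-refl

indicator : Bool → ℕ
indicator b = if b then 1 else 0

-- Dropping the positions 0, 1, 2 removes one multiple of 3 and lowers the ceiling by one;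
-- `multipleOf3` is invariant under the shift by three.
sum-multiplesOf3 : ∀ n → sum {n} (λ i → indicator (multipleOf3 (toℕ i))) ≡ ⌈ n /3⌉
sum-multiplesOf3 0                   = refl
sum-multiplesOf3 1                   = refl
sum-multiplesOf3 2                   = refl
sum-multiplesOf3 (suc (suc (suc n))) = trans (cong suc (sum-multiplesOf3 n)) (sym (⌈3+n/3⌉ n))

-- Residue 1 uses the predecessor, residue 2 the successor.
multipleOf3-nearby : ∀ i → multipleOf3 i ≡ false →
  (∃[ j ] i ≡ suc j × multipleOf3 j ≡ true) ⊎ multipleOf3 (suc i) ≡ true
multipleOf3-nearby 1                   _  = inj₁ (0 , refl , refl)
multipleOf3-nearby 2                   _  = inj₂ refl
multipleOf3-nearby (suc (suc (suc i))) eq with multipleOf3-nearby i eq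
... | inj₁ (j , refl , p) = inj₁ (suc (suc (suc j)) , refl , p)
... | inj₂ p              = inj₂ p

-- A last position congruent to 2 modulo 3 is followed cyclically by 0, again a multiple of 3.
multipleOf3-dominates-cycle : ∀ n (3≤n : 3 ≤ n) (g : Fin n) → multipleOf3 (toℕ g) ≡ false →
  ∃[ g′ ] Adj (C n 3≤n) g′ g × multipleOf3 (toℕ g′) ≡ true
multipleOf3-dominates-cycle (suc n) 3≤n g eq with multipleOf3-nearby (toℕ g) eq
... | inj₁ (j , g≡ , p) with prev-next g
...   | inj₁ q       = prev g , inj₁ (inj₁ q) , subst (λ x → multipleOf3 x ≡ true) (sym (suc-injective (trans q g≡))) p
...   | inj₂ (_ , q) = contradiction (trans (sym g≡) q) λ ()
multipleOf3-dominates-cycle (suc n) 3≤n g eq | inj₂ p with successor g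
... | g′ , inj₁ q       = g′ , inj₂ (inj₁ q) , subst (λ x → multipleOf3 x ≡ true) q p
... | g′ , inj₂ (r , q) = g′ , inj₂ (inj₂ (r , q)) , cong multipleOf3 q

module _ (n k : ℕ) (3≤n : 3 ≤ n) {m : ℕ} (H : Graph m) (H∈𝓗 : 𝓗 k H) (f : Fin n → Fin m) where

  open 𝓗 H∈𝓗

  centre : Fin n → Bool
  centre g = multipleOf3 (toℕ g)

  -- The type 2 edge between copies `g` and `g′` has the end `f g′` in copy `g`. A centre holds all
  -- its ends of such edges; any other copy may leave one end to be dominated from a neighbouring
  -- centre.
  TraceFor : Fin n → Bool → Subset m → Set
  TraceFor g true  S = Dominating H S × (∀ g′ → Adj (C n 3≤n) g′ g → f g′ ∈ S)
  TraceFor g false S = ∃[ g′ ] Adj (C n 3≤n) g′ g × centre g′ ≡ true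
    × (∀ h → h ≢ f g′ → DominatesAt H S h)

  trace : ∀ g → ∃[ S ] ∣ S ∣ ≡ k + indicator (centre g) × TraceFor g (centre g) S
  trace g with centre g in eq
  -- `f p` and `f q` may coincide, which `pairs` allows.
  ... | true with p , q , only ← cycle-neighbours n 3≤n g
             with S , (dom , ∣S∣≡γ) , p∈S , q∈S ← pairs (f p) (f q) =
    S , trans ∣S∣≡γ γ-graph , dom , attached
    where
    attached : ∀ g′ → Adj (C n 3≤n) g′ g → f g′ ∈ S
    attached g′ e with only g′ e
    ... | inj₁ refl = p∈S
    ... | inj₂ refl = q∈S
  -- The deleted vertex `f g′` is the one that the centre `g′` dominates from outside the copy.
  ... | false with g′ , g′g , c ← multipleOf3-dominates-cycle n 3≤n g eq
              with S , ∣S∣≡γ , dom ← γ-delete-witness H (f g′) =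
    S , trans ∣S∣≡γ (trans (γ-delete (f g′)) (+-comm 0 k)) , g′ , g′g , c , dom

  traces : Vec (Subset m) n
  traces = tabulate (proj₁ ∘ trace)

  -- Taking the equation as an argument makes this usable at a neighbour known to be a centre only
  -- through a proof.
  traces-for : ∀ g {b} → centre g ≡ b → TraceFor g b (lookup traces g)
  traces-for g refl = subst (TraceFor g (centre g)) (sym (lookup∘tabulate (proj₁ ∘ trace) g))
                            (proj₂ (proj₂ (trace g)))

  traces-dominate : ProductDominating (C n 3≤n) f H traces
  traces-dominate g h with centre g in eq
  ... | true  = inj₁ (proj₁ (traces-for g eq) h)
  ... | false with g′ , g′g , c , dom ← traces-for g eq with h ≟ f g′
  -- Since `g` is a neighbour of the centre `g′`, the trace at `g′` contains `f g`.
  ...   | yes h≡ = inj₂ (g′ , g′g , proj₂ (traces-for g′ c) g (symm (C n 3≤n) {g′} {g} g′g) , h≡)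
  ...   | no h≢  = inj₁ (dom h h≢)

  -- Each copy costs `k`, and each centre one more.
  ∣traces∣ : ∣ concat traces ∣ ≡ k * n + ⌈ n /3⌉
  ∣traces∣ = begin
    ∣ concat traces ∣                                   ≡⟨ ∣concat∣ traces ⟩
    sum (λ g → ∣ lookup traces g ∣)                     ≡⟨ sum-cong-≗ (λ g → trans (cong ∣_∣ (lookup∘tabulate (proj₁ ∘ trace) g)) (proj₁ (proj₂ (trace g)))) ⟩
    sum (λ g → k + indicator (centre g))                ≡⟨ ∑-distrib-+ (λ _ → k) (indicator ∘ centre) ⟩
    sum {n} (λ _ → k) + sum (indicator ∘ centre)        ≡⟨ cong₂ _+_ (trans (sum-const n k) (*-comm n k)) (sum-multiplesOf3 n) ⟩
    k * n + ⌈ n /3⌉                                     ∎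
    where open ≡-Reasoning

  upper-bound : γ (sierpińskiProduct (C n 3≤n) f H) ≤ k * n + ⌈ n /3⌉
  upper-bound = subst (γ (sierpińskiProduct (C n 3≤n) f H) ≤_) ∣traces∣
    (γ-minimal (sierpińskiProduct (C n 3≤n) f H) (concat traces) (productDominating⁺ (C n 3≤n) f H traces traces-dominate))

-- Assembling the two bounds.

γ-suc⇒vertex : ∀ {m k} (H : Graph m) → γ H ≡ k + 1 → Fin m
-- On no vertices `γ` computes to 0, which is not `k + 1`.
γ-suc⇒vertex {zero}  {k} H γH = contradiction (trans γH (+-comm k 1)) λ ()
γ-suc⇒vertex {suc m}     H γH = zero

theorem3p5 : ∀ (n k : ℕ) (3≤n : 3 ≤ n) → 1 ≤ k →
    ∀ {m : ℕ} (H : Graph m) → 𝓗 k H →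
    ΓS (C n 3≤n) H ≡ k * n + ⌈ n /3⌉
theorem3p5 n k 3≤n 1≤k H H∈𝓗 = ≤-antisym
  (ΓS-upper (C n 3≤n) H (upper-bound n k 3≤n H H∈𝓗))
  (ΓS-lower (C n 3≤n) H v (lower-bound n k 3≤n H γ-graph v))
  where
  open 𝓗 H∈𝓗
  -- Any vertex of `H` can serve as the constant value of `f` in the lower bound.
  v = γ-suc⇒vertex {k = k} H γ-graph
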